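{- For every $n\ge1$ let $A_n$ and $B_n$ denote the numbers of tilings of the regions $A_n$ and $B_n$ (defined in the context). Then $A_1=1$, $A_2=4$, $B_1=2$, $B_2=3$, and for all $n\ge1$ $$A_n=\frac14\left[(1+\sqrt2)^{n+1}+(1-\sqrt2)^{n+1}\right]+\frac12(-1)^n=\frac12H_{n+1}+\frac12(-1)^n,$$ $$B_n=\frac14\left[(1+\sqrt2)^{n+1}+(1-\sqrt2)^{n+1}\right]-\frac12(-1)^n=\frac12H_{n+1}-\frac12(-1)^n,$$ where $H_m=\frac{(1+\sqrt2)^m+(1-\sqrt2)^m}{2}$. Thus $(A_n)_{n\ge1}=(1,4,8,21,49,120,288,\dots)$ and $(B_n)_{n\ge1}=(2,3,9,20,50,119,289,\dots)$.
   Context: Let $s=\sqrt3/2$. Consider the standard triangular lattice in the plane whose vertices are the points $(a+b/2,\,bs)$ with $a,b\in\mathbb Z$ and whose edges are the unit segments joining lattice points in the directions $0^\circ,60^\circ,120^\circ$; it divides the plane into unit equilateral triangles called cells. A small tile is a single cell; a large tile is an equilateral triangle of side $2$ whose vertices are lattice points (so it is a union of $4$ cells; it may point up or down). For a region $R$ that is a finite union of cells, a tiling of $R$ is a finite set of small and large tiles, each contained in $R$, with pairwise disjoint interiors and union equal to $R$. For $n\ge1$, $A_n$ is the parallelogram with vertices $(0,0),(n,0),(n+1,2s),(1,2s)$ and $B_n$ is the trapezoid with vertices $(0,0),(n+1,0),(n,2s),(1,2s)$ (for $n=1$ it is a triangle of side $2$); each consists of $4n$ cells. By abuse of notation, $A_n$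 and $B_n$ also denote the number of tilings of these regions. -}

module Defs where

open import Algebra.Bundles.Raw using (RawSemiring)
import Algebra.Definitions.RawSemiring as RawSemiringDefs
open import Data.Integer as ℤ using (ℤ; +_; 0ℤ; 1ℤ)
open import Data.Fin using (Fin)
open import Data.List using (List; []; _∷_)
open import Data.List.Membership.Propositional using (_∈_)
open import Data.List.Relation.Binary.BagAndSetEquality using ([_]-Equality; set)
open import Data.List.Relation.Binary.Disjoint.Propositional using (Disjoint)
open import Data.List.Relation.Unary.All using (All)
open import Data.List.Relation.Unary.AllPairs using (AllPairs)
open import Data.List.Relation.Unary.Any using (Any)
open import Data.Nat using (ℕ; suc)
open import Data.Product using (_×_; _,_)
open import Data.Rational as ℚ using (ℚ; 0ℚ; 1ℚ)
open import Function.Bundles using (Inverse)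
open import Level using (0ℓ)
open import Relation.Binary.Bundles using (Setoid)
import Relation.Binary.Construct.On as On
open import Relation.Binary.PropositionalEquality using (_≡_; refl; setoid)
open import Relation.Unary using (Pred)

------------------------------------------------------------------------
-- The triangular lattice

-- (a , b) stands for the point (a + b/2 , b√3/2) of the plane.
Point : Set
Point = ℤ × ℤ

-- The up-pointing cell △ a b has lower left corner (a , b); the
-- down-pointing cell ▽ a b shares with it the edge from (a+1 , b) to
-- (a , b+1).
data Cell : Set where
  △ ▽ : ℤ → ℤ → Cell

vertices : Cell → List Point
vertices (△ a b) = (a , b) ∷ (a ℤ.+ 1ℤ , b) ∷ (a , b ℤ.+ 1ℤ) ∷ []
vertices (▽ a b) =
  (a ℤ.+ 1ℤ , b) ∷ (a , b ℤ.+ 1ℤ) ∷ (a ℤ.+ 1ℤ , b ℤ.+ 1ℤ) ∷ []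

-- A union of cells, given by the cells it consists of.
Region : Set₁
Region = Pred Cell 0ℓ

------------------------------------------------------------------------
-- Tiles and tilings

-- large△ a b is the triangle with vertices (a , b), (a+2 , b), (a , b+2);
-- large▽ a b is the triangle with vertices (a+2 , b), (a , b+2),
-- (a+2 , b+2).
data Tile : Set where
  small         : Cell → Tile
  large△ large▽ : ℤ → ℤ → Tile

cells : Tile → List Cell
cells (small c)    = c ∷ []
cells (large△ a b) =
  △ a b ∷ △ (a ℤ.+ 1ℤ) b ∷ △ a (b ℤ.+ 1ℤ) ∷ ▽ a b ∷ []
cells (large▽ a b) =
  ▽ (a ℤ.+ 1ℤ) b ∷ ▽ a (b ℤ.+ 1ℤ) ∷ ▽ (a ℤ.+ 1ℤ) (b ℤ.+ 1ℤ) ∷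
  △ (a ℤ.+ 1ℤ) (b ℤ.+ 1ℤ) ∷ []

-- Tiles are unions of cells, so their interiors are disjoint exactly when
-- they have no cell in common.
DisjointInteriors : Tile → Tile → Set
DisjointInteriors s t = Disjoint (cells s) (cells t)

record Tiling (R : Region) : Set where
  field
    tiles     : List Tile
    contained : All (λ t → All R (cells t)) tiles
    disjoint  : AllPairs DisjointInteriors tiles
    covering  : ∀ c → R c → Any (λ t → c ∈ cells t) tiles

-- A tiling is a set of tiles: the order of the list is irrelevant.
-- (The field disjoint already excludes repetitions.)
tilings : Region → Setoid 0ℓ 0ℓ
tilings R = On.setoid ([ set ]-Equality Tile) (Tiling.tiles {R})

NumberOfTilings : Region → ℕ → Set
NumberOfTilings R k = Inverse (setoid (Fin k)) (tilings R)

------------------------------------------------------------------------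
-- The two families of regions

-- A convex polygon contains a cell as soon as it contains its vertices.
cellsInside : Pred Point 0ℓ → Region
cellsInside P c = All P (vertices c)

-- Vertices (0 , 0), (n , 0), (n , 2), (0 , 2) in lattice coordinates,
-- that is (0,0), (n,0), (n+1,√3), (1,√3) in the plane.
parallelogram : ℕ → Region
parallelogram n = cellsInside λ (a , b) →
  0ℤ ℤ.≤ a × a ℤ.≤ + n × 0ℤ ℤ.≤ b × b ℤ.≤ + 2

-- Vertices (0 , 0), (n+1 , 0), (n-1 , 2), (0 , 2) in lattice coordinates,
-- that is (0,0), (n+1,0), (n,√3), (1,√3) in the plane.
trapezoid : ℕ → Region
trapezoid n = cellsInside λ (a , b) →
  0ℤ ℤ.≤ a × a ℤ.+ b ℤ.≤ + suc n × 0ℤ ℤ.≤ b × b ℤ.≤ + 2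

------------------------------------------------------------------------
-- The subfield ℚ(√2) of the real numbers

infix 5 _+√2·_

-- Since 1 and √2 are linearly independent over ℚ, the real number p + √2 q
-- determines p and q, so propositional equality is equality of reals.
record ℚ√2 : Set where
  constructor _+√2·_
  field
    rational   : ℚ
    irrational : ℚ

infixl 6 _+_ _-_
infixl 7 _*_

_+_ _-_ _*_ : ℚ√2 → ℚ√2 → ℚ√2
(p +√2· q) + (r +√2· s) = (p ℚ.+ r) +√2· (q ℚ.+ s)
(p +√2· q) - (r +√2· s) = (p ℚ.- r) +√2· (q ℚ.- s)
(p +√2· q) * (r +√2· s) =
  (p ℚ.* r ℚ.+ (+ 2 ℚ./ 1) ℚ.* (q ℚ.* s)) +√2· (p ℚ.* s ℚ.+ q ℚ.* r)

fromℚ : ℚ → ℚ√2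
fromℚ p = p +√2· 0ℚ

fromℕ : ℕ → ℚ√2
fromℕ n = fromℚ (+ n ℚ./ 1)

1# -1# √2 ½ ¼ : ℚ√2
1#  = fromℚ 1ℚ
-1# = fromℚ (ℚ.- 1ℚ)
√2  = 0ℚ +√2· 1ℚ
½   = fromℚ (1ℤ ℚ./ 2)
¼   = fromℚ (1ℤ ℚ./ 4)

ℚ√2-rawSemiring : RawSemiring 0ℓ 0ℓ
ℚ√2-rawSemiring = record
  { Carrier = ℚ√2
  ; _≈_     = _≡_
  ; _+_     = _+_
  ; _*_     = _*_
  ; 0#      = fromℚ 0ℚ
  ; 1#      = 1#
  }

open RawSemiringDefs ℚ√2-rawSemiring public using (_^_)

√2*√2≡2 : √2 * √2 ≡ fromℕ 2
√2*√2≡2 = refl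

H : ℕ → ℚ√2
H m = ½ * ((1# + √2) ^ m + (1# - √2) ^ m)

{-# OPTIONS --safe #-}
module Submission where

open import Defs
open import Data.Empty using (⊥; ⊥-elim)
open import Data.Fin using (Fin)
open import Data.Fin.Properties using (0↔⊥; 1↔⊤; +↔⊎)
open import Data.Integer as ℤ using (ℤ; +_; 0ℤ; 1ℤ)
import Data.Integer.Properties as ℤ
open import Data.List using (List; []; _∷_; map; filter; deduplicate; concatMap; upTo)
import Data.List.Membership.DecPropositional as DecMembership
open import Data.List.Membership.Propositional using (_∈_; find; lose)
open import Data.List.Membership.Propositional.Properties
  using (∈-filter⁺; ∈-filter⁻; ∈-deduplicate⁺; ∈-concatMap⁺; ∈-upTo⁺; ∈-upTo⁻; ∈-map⁺)
open import Data.List.Relation.Binary.BagAndSetEquality using (_∼[_]_; set)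
open import Data.List.Relation.Unary.All as All using (All; []; _∷_)
open import Data.List.Relation.Unary.AllPairs using (AllPairs; []; _∷_)
open import Data.List.Relation.Unary.Any as Any using (Any; here; there)
import Data.List.Relation.Unary.Unique.DecPropositional.Properties as DecUnique
open import Data.List.Relation.Unary.Unique.Propositional using (Unique)
import Data.List.Relation.Unary.Unique.Propositional.Properties as Unique
open import Data.Nat as ℕ using (ℕ; zero; suc; _≤_; _<_; z≤n; s≤s; z<s; s<s)
import Data.Nat.Properties as ℕ
open import Data.Product using (_×_; _,_; proj₁; proj₂; Σ-syntax; ∃-syntax; uncurry)
open import Data.Rational as ℚ using (ℚ; 0ℚ; 1ℚ)
import Data.Rational.Properties as ℚ
open import Data.Rational.Solver using (module +-*-Solver)
import Data.Rational.Unnormalised as ℚᵘ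
import Data.Rational.Unnormalised.Properties as ℚᵘ
open import Data.Sum using (_⊎_; inj₁; inj₂)
open import Data.Sum.Function.Propositional using (_⊎-↔_)
open import Data.Unit using (tt; ⊤)
open import Function using (_∘_)
open import Function.Bundles using (_↔_; _⇔_; mk⇔; mk↔ₛ′; module Equivalence; Inverse)
import Function.Construct.Composition as Composition
open Composition using (_↔-∘_)
open import Function.Construct.Symmetry using (↔-sym)
open import Level using (0ℓ)
open import Relation.Binary.Definitions using (DecidableEquality)
open import Relation.Binary.PropositionalEquality
  using (_≡_; _≢_; refl; sym; trans; cong; cong₂; subst; setoid)
open import Relation.Nullary using (¬_; Dec; yes; no; ¬?; contradiction; map′; _×-dec_)
open import Relation.Unary using (Pred; Decidable)

-- A large tile in a strip of height 2 is determined by its orientation and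
-- its centre, which lies over one of the points (1 , 0), …, (n , 0).  Two
-- large tiles overlap exactly when they have the same centre, or neighbouring
-- centres and the same orientation.  So tilings are words of length n over
-- {O, U, D} (no tile, up, down) without factors UU and DD.  At the left edge
-- no D can stand, as if a D preceded the word; at the right edge no U
-- (parallelogram) or no D (trapezoid), as if that letter followed it.  If
-- o, u, d count the words with right edge U that continue a letter O, U, D,
-- then (1 ± √2)^(n+1) = (u + d) ± o √2 and d - u = (-1)^n by induction on n.

-- Words between two boundary letters, and their number.

data Letter : Set where
  O U D : Letter

_~_ : Letter → Letter → Set
U ~ U = ⊥
D ~ D = ⊥
_ ~ _ = ⊤

-- `p` stands just before the word and `q` just behind it, so that both edges of a strip become
-- ordinary adjacency conditions.
data Word (q : Letter) : ℕ → Letter → Set where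
  end  : ∀ {p} → p ~ q → Word q 0 p
  step : ∀ {n p} x → p ~ x → Word q n x → Word q (suc n) p

edges : Letter → Letter → ℕ
edges U U = 0
edges D D = 0
edges _ _ = 1

count : Letter → ℕ → Letter → ℕ
count q zero    p = edges p q
count q (suc n) O = count q n O ℕ.+ (count q n U ℕ.+ count q n D)
count q (suc n) U = count q n O ℕ.+ count q n D
count q (suc n) D = count q n O ℕ.+ count q n U

end↔ : ∀ {p q} → Word q 0 p ↔ p ~ q
end↔ = mk↔ₛ′ (λ { (end r) → r }) end (λ _ → refl) (λ { (end _) → refl })

edges↔ : ∀ p q → Fin (edges p q) ↔ p ~ q
edges↔ U U = 0↔⊥
edges↔ D D = 0↔⊥
edges↔ O O = 1↔⊤
edges↔ O U = 1↔⊤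
edges↔ O D = 1↔⊤
edges↔ U O = 1↔⊤
edges↔ U D = 1↔⊤
edges↔ D O = 1↔⊤
edges↔ D U = 1↔⊤

module _ {q : Letter} {n : ℕ} where

  after-O : (Word q n O ⊎ Word q n U ⊎ Word q n D) ↔ Word q (suc n) O
  after-O = mk↔ₛ′
    (λ { (inj₁ w) → step O tt w ; (inj₂ (inj₁ w)) → step U tt w
       ; (inj₂ (inj₂ w)) → step D tt w })
    (λ { (step O _ w) → inj₁ w ; (step U _ w) → inj₂ (inj₁ w)
       ; (step D _ w) → inj₂ (inj₂ w) })
    (λ { (step O _ w) → refl ; (step U _ w) → refl ; (step D _ w) → refl })
    (λ { (inj₁ _) → refl ; (inj₂ (inj₁ _)) → refl ; (inj₂ (inj₂ _)) → refl })

  after-U : (Word q n O ⊎ Word q n D) ↔ Word q (suc n) U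
  after-U = mk↔ₛ′
    (λ { (inj₁ w) → step O tt w ; (inj₂ w) → step D tt w })
    (λ { (step O _ w) → inj₁ w ; (step D _ w) → inj₂ w })
    (λ { (step O _ w) → refl ; (step D _ w) → refl })
    (λ { (inj₁ _) → refl ; (inj₂ _) → refl })

  after-D : (Word q n O ⊎ Word q n U) ↔ Word q (suc n) D
  after-D = mk↔ₛ′
    (λ { (inj₁ w) → step O tt w ; (inj₂ w) → step U tt w })
    (λ { (step O _ w) → inj₁ w ; (step U _ w) → inj₂ w })
    (λ { (step O _ w) → refl ; (step U _ w) → refl })
    (λ { (inj₁ _) → refl ; (inj₂ _) → refl })

count-words : ∀ q n p → Fin (count q n p) ↔ Word q n p
count-words q zero    p = ↔-sym end↔ ↔-∘ edges↔ p q
count-words q (suc n) O =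
  after-O ↔-∘
    ((count-words q n O ⊎-↔ ((count-words q n U ⊎-↔ count-words q n D) ↔-∘ +↔⊎)) ↔-∘ +↔⊎)
count-words q (suc n) U = after-U ↔-∘ ((count-words q n O ⊎-↔ count-words q n D) ↔-∘ +↔⊎)
count-words q (suc n) D = after-D ↔-∘ ((count-words q n O ⊎-↔ count-words q n U) ↔-∘ +↔⊎)

-- Words as sequences of letters.

~O : ∀ p → p ~ O
~O O = tt
~O U = tt
~O D = tt

O~ : ∀ q → O ~ q
O~ q = tt

~-irrelevant : ∀ p q (r s : p ~ q) → r ≡ s
~-irrelevant O q _ _ = refl
~-irrelevant U O _ _ = refl
~-irrelevant U D _ _ = refl
~-irrelevant D O _ _ = refl
~-irrelevant D U _ _ = refl

~-intro : ∀ p q → ¬ (p ≡ U × q ≡ U) → ¬ (p ≡ D × q ≡ D) → p ~ q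
~-intro O _ _ _ = tt
~-intro U O _ _ = tt
~-intro U U ¬UU _ = ¬UU (refl , refl)
~-intro U D _ _ = tt
~-intro D O _ _ = tt
~-intro D U _ _ = tt
~-intro D D _ ¬DD = ¬DD (refl , refl)

module _ {q : Letter} where

  -- Index 0 is the preceding letter `p`. Indices beyond the end give `O`, which may follow any
  -- letter, so adjacency holds at every index.
  letters : ∀ {n p} → Word q n p → ℕ → Letter
  letters {p = p} w zero = p
  letters (end _)      (suc i) = O
  letters (step _ _ w) (suc i) = letters w i

  letters-~ : ∀ {n p} (w : Word q n p) i → letters w i ~ letters w (suc i)
  letters-~ {p = p} (end _) zero = ~O p
  letters-~ (end _)      (suc i) = tt
  letters-~ (step _ r _) zero    = r
  letters-~ (step _ _ w) (suc i) = letters-~ w i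

  letters-last : ∀ {n p} (w : Word q n p) → letters w n ~ q
  letters-last (end r)      = r
  letters-last (step _ _ w) = letters-last w

  letters-injective : ∀ {n p} (w w′ : Word q n p) →
    (∀ i → i ≤ n → letters w i ≡ letters w′ i) → w ≡ w′
  letters-injective {p = p} (end r) (end s) _ = cong end (~-irrelevant p q r s)
  letters-injective {p = p} (step x r w) (step y s w′) eq with refl ← eq 1 (s≤s z≤n) =
    cong₂ (step x) (~-irrelevant p x r s) (letters-injective w w′ λ i → eq (suc i) ∘ s≤s)

  read : ∀ n (f : ℕ → Letter) → (∀ i → i < n → f i ~ f (suc i)) → f n ~ q → Word q n (f 0)
  read zero    f r e = end e
  read (suc n) f r e = step (f 1) (r 0 z<s) (read n (f ∘ suc) (λ i → r (suc i) ∘ s<s) e)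

  letters-read : ∀ n f r e i → i ≤ n → letters (read n f r e) i ≡ f i
  letters-read n       f r e zero    _         = refl
  letters-read (suc n) f r e (suc i) (s≤s i≤n) = letters-read n (f ∘ suc) _ e i i≤n

-- The exchange of `U` and `D`.

swap : Letter → Letter
swap O = O
swap U = D
swap D = U

edges-swap : ∀ p q → edges (swap p) (swap q) ≡ edges p q
edges-swap O O = refl
edges-swap O U = refl
edges-swap O D = refl
edges-swap U O = refl
edges-swap U U = refl
edges-swap U D = refl
edges-swap D O = refl
edges-swap D U = refl
edges-swap D D = refl

-- Adjacency is invariant under the exchange. With `q` and `p` both `U` this turns the trapezoid
-- count `count D n D` into `count U n U`.
count-swap : ∀ q n p → count (swap q) n (swap p) ≡ count q n p
count-swap q zero    p = edges-swap p q
count-swap q (suc n) O = cong₂ ℕ._+_ (count-swap q n O)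
  (trans (cong₂ ℕ._+_ (count-swap q n D) (count-swap q n U)) (ℕ.+-comm (count q n D) _))
count-swap q (suc n) U = cong₂ ℕ._+_ (count-swap q n O) (count-swap q n D)
count-swap q (suc n) D = cong₂ ℕ._+_ (count-swap q n O) (count-swap q n U)

-- The closed formulas in ℚ(√2).

fromNat : ℕ → ℚ
fromNat n = + n ℚ./ 1

-- Rationals are kept in lowest terms, so the sum does not compute for variables; among unnormalised
-- fractions with denominator 1 it is an identity of numerators.
fromNat-+ : ∀ m n → fromNat (m ℕ.+ n) ≡ fromNat m ℚ.+ fromNat n
fromNat-+ m n = ℚ.toℚᵘ-injective (begin
  ℚ.toℚᵘ (fromNat (m ℕ.+ n))                  ≈⟨ cast (m ℕ.+ n) ⟩
  + (m ℕ.+ n) ℚᵘ./ 1                          ≈⟨ ℚᵘ.*≡* (cong (ℤ._* 1ℤ) (sym identities)) ⟩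
  (+ m ℚᵘ./ 1) ℚᵘ.+ (+ n ℚᵘ./ 1)              ≈⟨ ℚᵘ.+-cong (cast m) (cast n) ⟨
  ℚ.toℚᵘ (fromNat m) ℚᵘ.+ ℚ.toℚᵘ (fromNat n)  ≈⟨ ℚ.toℚᵘ-homo-+ (fromNat m) (fromNat n) ⟨
  ℚ.toℚᵘ (fromNat m ℚ.+ fromNat n)            ∎)
  where
  open ℚᵘ.≃-Reasoning

  cast : ∀ k → ℚ.toℚᵘ (fromNat k) ℚᵘ.≃ (+ k ℚᵘ./ 1)
  cast k = ℚ.toℚᵘ-fromℚᵘ (+ k ℚᵘ./ 1)

  identities : + m ℤ.* 1ℤ ℤ.+ + n ℤ.* 1ℤ ≡ + m ℤ.+ + n
  identities = cong₂ ℤ._+_ (ℤ.*-identityʳ (+ m)) (ℤ.*-identityʳ (+ n))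

-- The first two are the coordinates of (1 + √2)^(n+1), the third is (-1)^n.
rational-part irrational-part sign : ℕ → ℚ
rational-part   n = fromNat (count U n U) ℚ.+ fromNat (count U n D)
irrational-part n = fromNat (count U n O)
sign            n = fromNat (count U n D) ℚ.- fromNat (count U n U)

open +-*-Solver using (solve; _:=_; _:+_; _:-_; :-_; _:*_; con)

private
  half quarter two : ℚ
  half    = 1ℤ ℚ./ 2
  quarter = 1ℤ ℚ./ 4
  two     = + 2 ℚ./ 1

rational-step : ∀ n → rational-part (suc n) ≡ rational-part n ℚ.+ two ℚ.* irrational-part n
rational-step n = trans
  (cong₂ ℚ._+_ (fromNat-+ (count U n O) (count U n D)) (fromNat-+ (count U n O) (count U n U)))
  (solve 3 (λ o u d → (o :+ d) :+ (o :+ u) := (u :+ d) :+ con two :* o) refl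
    (fromNat (count U n O)) (fromNat (count U n U)) (fromNat (count U n D)))

irrational-step : ∀ n → irrational-part (suc n) ≡ irrational-part n ℚ.+ rational-part n
irrational-step n = trans (fromNat-+ (count U n O) (count U n U ℕ.+ count U n D))
  (cong (fromNat (count U n O) ℚ.+_) (fromNat-+ (count U n U) (count U n D)))

sign-step : ∀ n → sign (suc n) ≡ ℚ.- sign n
sign-step n = trans
  (cong₂ ℚ._-_ (fromNat-+ (count U n O) (count U n U)) (fromNat-+ (count U n O) (count U n D)))
  (solve 3 (λ o u d → (o :+ u) :- (o :+ d) := :- (d :- u)) refl
    (fromNat (count U n O)) (fromNat (count U n U)) (fromNat (count U n D)))

power⁺ : ∀ n → (1# + √2) ^ suc n ≡ rational-part n +√2· irrational-part n
-- For the empty word u = 0 and o = d = 1, which gives 1 + √2.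
power⁺ zero = refl
power⁺ (suc n) = trans (cong ((1# + √2) *_) (power⁺ n)) (cong₂ _+√2·_
  (trans (solve 2 (λ r i → con 1ℚ :* r :+ con two :* (con 1ℚ :* i) := r :+ con two :* i)
           refl (rational-part n) (irrational-part n))
         (sym (rational-step n)))
  (trans (solve 2 (λ r i → con 1ℚ :* i :+ con 1ℚ :* r := i :+ r)
           refl (rational-part n) (irrational-part n))
         (sym (irrational-step n))))

power⁻ : ∀ n → (1# - √2) ^ suc n ≡ rational-part n +√2· (ℚ.- irrational-part n)
power⁻ zero = refl
power⁻ (suc n) = trans (cong ((1# - √2) *_) (power⁻ n)) (cong₂ _+√2·_
  (trans (solve 2 (λ r i → con 1ℚ :* r :+ con two :* ((:- con 1ℚ) :* (:- i)) :=
                           r :+ con two :* i)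
           refl (rational-part n) (irrational-part n))
         (sym (rational-step n)))
  (trans (solve 2 (λ r i → con 1ℚ :* (:- i) :+ (:- con 1ℚ) :* r := :- (i :+ r))
           refl (rational-part n) (irrational-part n))
         (cong ℚ.-_ (sym (irrational-step n)))))

power-sign : ∀ n → -1# ^ n ≡ fromℚ (sign n)
power-sign zero = refl
power-sign (suc n) = trans (cong (-1# *_) (power-sign n)) (cong₂ _+√2·_
  (trans (solve 1 (λ s → (:- con 1ℚ) :* s :+ con two :* con 0ℚ := :- s) refl (sign n))
         (sym (sign-step n)))
  (solve 1 (λ s → (:- con 1ℚ) :* con 0ℚ :+ con 0ℚ :* s := con 0ℚ) refl (sign n)))

-- `H` carries a factor ½ of its own; this reconciles the two forms of each formula.
½*½ : ∀ x → ½ * (½ * x) ≡ ¼ * x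
½*½ (r +√2· s) = cong₂ _+√2·_
  (solve 2 (λ r s → con half :* (con half :* r :+ con two :* (con 0ℚ :* s))
                      :+ con two :* (con 0ℚ :* (con half :* s :+ con 0ℚ :* r)) :=
                    con quarter :* r :+ con two :* (con 0ℚ :* s))
    refl r s)
  (solve 2 (λ r s → con half :* (con half :* s :+ con 0ℚ :* r)
                      :+ con 0ℚ :* (con half :* r :+ con two :* (con 0ℚ :* s)) :=
                    con quarter :* s :+ con 0ℚ :* r)
    refl r s)

module _ (n : ℕ) where

  private
    d u i : ℚ
    d = fromNat (count U n D)
    u = fromNat (count U n U)
    i = irrational-part n

  -- The irrational coordinates of the two powers cancel and leave 2(u + d); a quarter of this plus
  -- half of d - u is d. In `formula⁻`, subtracting that half leaves u.
  formula⁺ : fromℕ (count U n D) ≡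
    ¼ * ((1# + √2) ^ suc n + (1# - √2) ^ suc n) + ½ * -1# ^ n
  formula⁺ = sym (trans
    (cong₂ (λ x y → ¼ * x + ½ * y) (cong₂ _+_ (power⁺ n) (power⁻ n)) (power-sign n))
    (cong₂ _+√2·_
      (solve 3 (λ d u i →
           (con quarter :* ((u :+ d) :+ (u :+ d)) :+ con two :* (con 0ℚ :* (i :+ :- i)))
             :+ (con half :* (d :- u) :+ con two :* (con 0ℚ :* con 0ℚ)) := d)
        refl d u i)
      (solve 3 (λ d u i →
           (con quarter :* (i :+ :- i) :+ con 0ℚ :* ((u :+ d) :+ (u :+ d)))
             :+ (con half :* con 0ℚ :+ con 0ℚ :* (d :- u)) := con 0ℚ)
        refl d u i)))

  formula⁻ : fromℕ (count U n U) ≡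
    ¼ * ((1# + √2) ^ suc n + (1# - √2) ^ suc n) - ½ * -1# ^ n
  formula⁻ = sym (trans
    (cong₂ (λ x y → ¼ * x - ½ * y) (cong₂ _+_ (power⁺ n) (power⁻ n)) (power-sign n))
    (cong₂ _+√2·_
      (solve 3 (λ d u i →
           (con quarter :* ((u :+ d) :+ (u :+ d)) :+ con two :* (con 0ℚ :* (i :+ :- i)))
             :- (con half :* (d :- u) :+ con two :* (con 0ℚ :* con 0ℚ)) := u)
        refl d u i)
      (solve 3 (λ d u i →
           (con quarter :* (i :+ :- i) :+ con 0ℚ :* ((u :+ d) :+ (u :+ d)))
             :- (con half :* con 0ℚ :+ con 0ℚ :* (d :- u)) := con 0ℚ)
        refl d u i)))

-- Tilings and their large tiles.

_≟ᶜ_ : DecidableEquality Cell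
△ a b ≟ᶜ △ c d = map′ (uncurry (cong₂ △)) (λ { refl → refl , refl }) (a ℤ.≟ c ×-dec b ℤ.≟ d)
△ _ _ ≟ᶜ ▽ _ _ = no λ ()
▽ _ _ ≟ᶜ △ _ _ = no λ ()
▽ a b ≟ᶜ ▽ c d = map′ (uncurry (cong₂ ▽)) (λ { refl → refl , refl }) (a ℤ.≟ c ×-dec b ℤ.≟ d)

_≟ᵗ_ : DecidableEquality Tile
small c    ≟ᵗ small d    = map′ (cong small) (λ { refl → refl }) (c ≟ᶜ d)
small _    ≟ᵗ large△ _ _ = no λ ()
small _    ≟ᵗ large▽ _ _ = no λ ()
large△ _ _ ≟ᵗ small _    = no λ ()
large△ a b ≟ᵗ large△ c d =
  map′ (uncurry (cong₂ large△)) (λ { refl → refl , refl }) (a ℤ.≟ c ×-dec b ℤ.≟ d)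
large△ _ _ ≟ᵗ large▽ _ _ = no λ ()
large▽ _ _ ≟ᵗ small _    = no λ ()
large▽ _ _ ≟ᵗ large△ _ _ = no λ ()
large▽ a b ≟ᵗ large▽ c d =
  map′ (uncurry (cong₂ large▽)) (λ { refl → refl , refl }) (a ℤ.≟ c ×-dec b ℤ.≟ d)

open DecMembership _≟ᶜ_ using () renaming (_∈?_ to _∈ᶜ?_)

data Large : Tile → Set where
  large△ : ∀ {a b} → Large (large△ a b)
  large▽ : ∀ {a b} → Large (large▽ a b)

common-cell : ∀ {ts s t c} → AllPairs DisjointInteriors ts →
  s ∈ ts → t ∈ ts → c ∈ cells s → c ∈ cells t → s ≡ t
common-cell _       (here refl) (here refl) _   _   = refl
common-cell (d ∷ _) (here refl) (there t∈)  c∈s c∈t = ⊥-elim (All.lookup d t∈ (c∈s , c∈t))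
common-cell (d ∷ _) (there s∈)  (here refl) c∈s c∈t = ⊥-elim (All.lookup d s∈ (c∈t , c∈s))
common-cell (_ ∷ d) (there s∈)  (there t∈)  c∈s c∈t = common-cell d s∈ t∈ c∈s c∈t

allPairs : ∀ {A : Set} {S : A → A → Set} {xs} → Unique xs →
  (∀ {x y} → x ∈ xs → y ∈ xs → x ≢ y → S x y) → AllPairs S xs
allPairs []       _ = []
allPairs (x≢ ∷ u) S =
  All.tabulate (λ y∈ → S (here refl) (there y∈) (All.lookup x≢ y∈)) ∷
  allPairs u (λ x∈ y∈ → S (there x∈) (there y∈))

module _ {R : Region} where
  open Tiling

  -- The tile of `T′` over `c` cannot be large: it would then belong to `T` as well and share `c`
  -- with `small c` there.
  small-determined : (T T′ : Tiling R) →
    (∀ {t} → Large t → t ∈ tiles T′ → t ∈ tiles T) →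
    ∀ {c} → small c ∈ tiles T → small c ∈ tiles T′
  small-determined T T′ large⊆ {c} c∈T
    with find (covering T′ c (All.head (All.lookup (contained T) c∈T)))
  ... | small _    , t∈ , here refl = t∈
  ... | large△ _ _ , t∈ , c∈t
    with () ← common-cell (disjoint T) c∈T (large⊆ large△ t∈) (here refl) c∈t
  ... | large▽ _ _ , t∈ , c∈t
    with () ← common-cell (disjoint T) c∈T (large⊆ large▽ t∈) (here refl) c∈t

  tiling-determined : (T T′ : Tiling R) →
    (∀ {t} → Large t → t ∈ tiles T ⇔ t ∈ tiles T′) → tiles T ∼[ set ] tiles T′
  tiling-determined T T′ eq {small _} = mk⇔
    (small-determined T T′ (λ l → Equivalence.from (eq l)))
    (small-determined T′ T (λ l → Equivalence.to (eq l)))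
  tiling-determined T T′ eq {large△ _ _} = eq large△
  tiling-determined T T′ eq {large▽ _ _} = eq large▽

-- A decidable family `P` of disjoint large tiles extends to a tiling: keep its members inside the
-- region and put a small tile on every cell that they leave free. The list `candidates` makes the
-- search finite.
module Filling
  {R : Region} (R? : Decidable R)
  (candidates : List Tile) (complete : ∀ {t} → All R (cells t) → t ∈ candidates)
  {P : Pred Tile 0ℓ} (P? : Decidable P) (P⇒Large : ∀ {t} → P t → Large t)
  (P-disjoint : ∀ {s t c} → P s → P t → c ∈ cells s → c ∈ cells t → s ≡ t)
  where

  Inside : Pred Tile 0ℓ
  Inside t = All R (cells t)

  inside? : Decidable Inside
  inside? t = All.all? R? (cells t)

  available : List Tile
  available = filter inside? (deduplicate _≟ᵗ_ candidates)

  ∈-available : ∀ {t} → Inside t → t ∈ available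
  ∈-available i = ∈-filter⁺ inside? (∈-deduplicate⁺ _≟ᵗ_ (complete i)) i

  Covered : Pred Cell 0ℓ
  Covered c = Any (λ t → c ∈ cells t) (filter P? available)

  covered? : Decidable Covered
  covered? c = Any.any? (λ t → c ∈ᶜ? cells t) (filter P? available)

  data Kept : Tile → Set where
    chosen : ∀ {t} → P t → Kept t
    loose  : ∀ {c} → ¬ Covered c → Kept (small c)

  kept? : Decidable Kept
  kept? (small c)    = map′ loose
    (λ { (loose ¬cov) → ¬cov ; (chosen p) → contradiction (P⇒Large p) λ () }) (¬? (covered? c))
  kept? (large△ a b) = map′ chosen (λ { (chosen p) → p }) (P? _)
  kept? (large▽ a b) = map′ chosen (λ { (chosen p) → p }) (P? _)

  -- `Covered` only refers to tiles inside the region, so it is the containment of a chosen tile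
  -- that makes its cells covered and excludes a loose tile there.
  kept-disjoint : ∀ {s t c} → Inside s → Inside t → Kept s → Kept t →
    c ∈ cells s → c ∈ cells t → s ≡ t
  kept-disjoint _ _ (chosen p)    (chosen p′)   c∈s         c∈t         = P-disjoint p p′ c∈s c∈t
  kept-disjoint i _ (chosen p)    (loose ¬cov)  c∈s         (here refl) =
    contradiction (lose (∈-filter⁺ P? (∈-available i) p) c∈s) ¬cov
  kept-disjoint _ i (loose ¬cov)  (chosen p)    (here refl) c∈t         =
    contradiction (lose (∈-filter⁺ P? (∈-available i) p) c∈t) ¬cov
  kept-disjoint _ _ (loose _)     (loose _)     (here refl) (here refl) = refl

  filling : List Tile
  filling = filter kept? available

  ∈-filling⁺ : ∀ {t} → Inside t → Kept t → t ∈ filling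
  ∈-filling⁺ i = ∈-filter⁺ kept? (∈-available i)

  ∈-filling⁻ : ∀ {t} → t ∈ filling → Inside t × Kept t
  ∈-filling⁻ t∈ with t∈a , k ← ∈-filter⁻ kept? {xs = available} t∈ =
    proj₂ (∈-filter⁻ inside? {xs = deduplicate _≟ᵗ_ candidates} t∈a) , k

  fill : Tiling R
  fill = record
    { tiles     = filling
    ; contained = All.tabulate (proj₁ ∘ ∈-filling⁻)
    ; disjoint  = allPairs
        (Unique.filter⁺ kept? (Unique.filter⁺ inside? (DecUnique.deduplicate-! _≟ᵗ_ candidates)))
        λ s∈ t∈ s≢t (c∈s , c∈t) →
          let is , ks = ∈-filling⁻ s∈ ; it , kt = ∈-filling⁻ t∈
          in s≢t (kept-disjoint is it ks kt c∈s c∈t)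
    ; covering  = cover
    }
    where
    cover : ∀ c → R c → Any (λ t → c ∈ cells t) filling
    cover c r with covered? c
    ... | no ¬cov = lose (∈-filling⁺ (r ∷ []) (loose ¬cov)) (here refl)
    ... | yes cov with t , t∈ , c∈t ← find cov
                  with t∈a , p ← ∈-filter⁻ P? {xs = available} t∈ =
      lose (∈-filter⁺ kept? t∈a (chosen p)) c∈t

  large∈fill : ∀ {t} → Large t → t ∈ filling → P t
  large∈fill l t∈ with proj₂ (∈-filling⁻ t∈) | l
  ... | chosen p | _ = p

-- Positions of large tiles and their overlaps.

-- Large tiles in a strip of height 2 are numbered by their centres: At x i t
-- says that t is the large tile of type x whose centre lies over (i , 0).
data At : Letter → ℕ → Tile → Set where
  up   : ∀ {i} → At U (suc i)       (large△ (+ i) 0ℤ)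
  down : ∀ {i} → At D (suc (suc i)) (large▽ (+ i) 0ℤ)

at? : ∀ x i → Decidable (At x i)
at? O _             _ = no λ ()
at? U zero          _ = no λ ()
at? U (suc i)       t = map′ (λ { refl → up }) (λ { up → refl }) (t ≟ᵗ large△ (+ i) 0ℤ)
at? D zero          _ = no λ ()
at? D (suc zero)    _ = no λ ()
at? D (suc (suc i)) t = map′ (λ { refl → down }) (λ { down → refl }) (t ≟ᵗ large▽ (+ i) 0ℤ)

At⇒Large : ∀ {x i t} → At x i t → Large t
At⇒Large up   = large△
At⇒Large down = large▽

At-functional : ∀ {x i s t} → At x i s → At x i t → s ≡ t
At-functional up   up   = refl
At-functional down down = refl

At-injective : ∀ {x y i j t} → At x i t → At y j t → x ≡ y × i ≡ j
At-injective up   up   = refl , refl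
At-injective down down = refl , refl

-- Site c x i: the cell c may belong to a large tile of type x at position i.
-- A central cell of a tile only fixes the position; a corner cell fixes the
-- type and leaves two consecutive positions.
data Site : Cell → Letter → ℕ → Set where
  △₀ˡ : ∀ {k}   → Site (△ (+ k) 0ℤ) U (suc k)
  △₀ʳ : ∀ {k}   → Site (△ (+ k) 0ℤ) U k
  △₁  : ∀ {k x} → Site (△ (+ k) 1ℤ) x (suc k)
  ▽₀  : ∀ {k x} → Site (▽ (+ k) 0ℤ) x (suc k)
  ▽₁ˡ : ∀ {k}   → Site (▽ (+ k) 1ℤ) D (suc (suc k))
  ▽₁ʳ : ∀ {k}   → Site (▽ (+ k) 1ℤ) D (suc k)

site : ∀ {x i t c} → At x i t → c ∈ cells t → Site c x i
site up (here refl) = △₀ˡ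
-- The coordinate computes to `i + 1`, while `Site` expects a successor; the rewrites below do the
-- same.
site (up {i}) (there (here refl)) rewrite ℕ.+-comm i 1 = △₀ʳ
site up (there (there (here refl))) = △₁
site up (there (there (there (here refl)))) = ▽₀
site (down {i}) (here refl) rewrite ℕ.+-comm i 1 = ▽₀
site down (there (here refl)) = ▽₁ˡ
site (down {i}) (there (there (here refl))) rewrite ℕ.+-comm i 1 = ▽₁ʳ
site (down {i}) (there (there (there (here refl)))) rewrite ℕ.+-comm i 1 = △₁

Compatible : (ℕ → Letter) → Set
Compatible f = ∀ i → f i ~ f (suc i)

not-consecutive : ∀ {f x} → Compatible f → ∀ i → x ≢ O → f i ≡ x → f (suc i) ≡ x → ⊥
not-consecutive {x = O} r i x≢O p q = x≢O refl
not-consecutive {x = U} r i _ p q with r i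
... | s rewrite p | q = s
not-consecutive {x = D} r i _ p q with r i
... | s rewrite p | q = s

-- Two different positions for one cell are always neighbours of the same type, so choosing both
-- would produce a factor UU or DD.
site-unique : ∀ {f c x y i j} → Compatible f → Site c x i → Site c y j →
  f i ≡ x → f j ≡ y → i ≡ j
site-unique r △₀ˡ △₀ˡ p q = refl
site-unique r △₀ˡ △₀ʳ p q = ⊥-elim (not-consecutive r _ (λ ()) q p)
site-unique r △₀ʳ △₀ˡ p q = ⊥-elim (not-consecutive r _ (λ ()) p q)
site-unique r △₀ʳ △₀ʳ p q = refl
site-unique r △₁  △₁  p q = refl
site-unique r ▽₀  ▽₀  p q = refl
site-unique r ▽₁ˡ ▽₁ˡ p q = refl
site-unique r ▽₁ˡ ▽₁ʳ p q = ⊥-elim (not-consecutive r _ (λ ()) q p)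
site-unique r ▽₁ʳ ▽₁ˡ p q = ⊥-elim (not-consecutive r _ (λ ()) p q)
site-unique r ▽₁ʳ ▽₁ʳ p q = refl

-- The range includes the boundary index 0, where `At` has no tile.
Selected : (ℕ → Letter) → ℕ → Tile → Set
Selected f n t = Any (λ i → At (f i) i t) (upTo (suc n))

selected? : ∀ f n → Decidable (Selected f n)
selected? f n t = Any.any? (λ i → at? (f i) i t) (upTo (suc n))

selected⁺ : ∀ {f n i t} → i ≤ n → At (f i) i t → Selected f n t
selected⁺ i≤n = lose (∈-upTo⁺ (s≤s i≤n))

selected⁻ : ∀ {f n t} → Selected f n t → ∃[ i ] i ≤ n × At (f i) i t
selected⁻ s with i , i∈ , a ← find s = i , ℕ.s≤s⁻¹ (∈-upTo⁻ i∈) , a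

selected-disjoint : ∀ {f n s t c} → Compatible f → Selected f n s → Selected f n t →
  c ∈ cells s → c ∈ cells t → s ≡ t
selected-disjoint r σ τ c∈s c∈t
  with i , _ , a ← selected⁻ σ | j , _ , b ← selected⁻ τ
  with refl ← site-unique r (site a c∈s) (site b c∈t) refl refl = At-functional a b

-- The word of a tiling.

module _ {R : Region} (T : Tiling R) where
  open Tiling T

  -- Index 0 holds the imagined `D` at the left edge. Testing `U` before `D` loses nothing, because
  -- an up and a down tile at the same position overlap.
  letterOf : ℕ → Letter
  letterOf zero = D
  letterOf (suc i) with Any.any? (at? U (suc i)) tiles | Any.any? (at? D (suc i)) tiles
  ... | yes _ | _     = U
  ... | no _  | yes _ = D
  ... | no _  | no _  = O

  letterOf-present : ∀ i →
    letterOf (suc i) ≡ O ⊎ ∃[ t ] At (letterOf (suc i)) (suc i) t × t ∈ tiles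
  letterOf-present i with Any.any? (at? U (suc i)) tiles | Any.any? (at? D (suc i)) tiles
  ... | yes a | _     = inj₂ (let t , t∈ , p = find a in t , p , t∈)
  ... | no _  | yes a = inj₂ (let t , t∈ , p = find a in t , p , t∈)
  ... | no _  | no _  = inj₁ refl

  At-letterOf : ∀ {i t} → At (letterOf i) i t → t ∈ tiles
  At-letterOf {suc i} a with letterOf-present i
  ... | inj₂ (t , b , t∈) = subst (_∈ tiles) (At-functional b a) t∈
  ... | inj₁ eq with () ← subst (λ x → At x _ _) eq a

  -- Large tiles of both types over the same centre (i , 0) share the cell
  -- ▽ (i - 1) 0.
  letterOf-At : ∀ {x i t} → At x i t → t ∈ tiles → letterOf i ≡ x
  letterOf-At {i = suc i} a t∈ with Any.any? (at? U (suc i)) tiles | Any.any? (at? D (suc i)) tiles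
  letterOf-At up t∈ | yes _ | _ = refl
  letterOf-At up t∈ | no ¬u | _ = contradiction (lose t∈ up) ¬u
  letterOf-At down t∈ | no _ | yes _ = refl
  letterOf-At down t∈ | no _ | no ¬d = contradiction (lose t∈ down) ¬d
  letterOf-At (down {i}) t∈ | yes u | _ with s , s∈ , up ← find u
    with () ← common-cell disjoint s∈ t∈ (there (there (there (here refl))))
                (here (cong (λ k → ▽ (+ k) 0ℤ) (ℕ.+-comm 1 i)))

  -- If the letter is not `O`, a tile of that type is present, and the last hypothesis forces its
  -- type to be `x`. Later comparisons of letters thus avoid repeating the search in the list.
  letterOf-unique : ∀ {x} i → x ≡ O ⊎ (∃[ t ] At x (suc i) t × t ∈ tiles) →
    (∀ {y t} → At y (suc i) t → t ∈ tiles → y ≡ x) → letterOf (suc i) ≡ x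
  letterOf-unique i (inj₂ (t , a , t∈)) _ = letterOf-At a t∈
  letterOf-unique i (inj₁ refl) only with letterOf-present i
  ... | inj₁ eq            = eq
  ... | inj₂ (t , a , t∈) = only a t∈

  letterOf-compatible : Compatible letterOf
  letterOf-compatible i = ~-intro _ _ (λ (p , q) → ¬UU i p q) (λ (p , q) → ¬DD i p q)
    where
    present : ∀ {i x t} → At x i t → letterOf i ≡ x → t ∈ tiles
    present a refl = At-letterOf a

    ¬UU : ∀ i → letterOf i ≡ U → letterOf (suc i) ≡ U → ⊥
    -- Neighbouring up tiles share the bottom cell `△ (i + 1) 0`.
    ¬UU (suc i) p q
      with () ← common-cell disjoint (present (up {i}) p) (present (up {suc i}) q)
                  (there (here refl)) (here (cong (λ k → △ (+ k) 0ℤ) (ℕ.+-comm i 1)))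

    ¬DD : ∀ i → letterOf i ≡ D → letterOf (suc i) ≡ D → ⊥
    -- No down tile has position 1, so neither of the first two index pairs can read DD.
    ¬DD zero p q with letterOf-present 0
    ... | inj₁ eq with () ← trans (sym eq) q
    ... | inj₂ (t , a , _) rewrite q with () ← a
    ¬DD (suc zero) p q with letterOf-present 0
    ... | inj₁ eq with () ← trans (sym eq) p
    ... | inj₂ (t , a , _) rewrite p with () ← a
    -- Neighbouring down tiles share the top cell `▽ (i + 1) 1`.
    ¬DD (suc (suc i)) p q
      with () ← common-cell disjoint (present (down {i}) p) (present (down {suc i}) q)
                  (there (there (here refl))) (there (here (cong (λ k → ▽ (+ k) 1ℤ) (ℕ.+-comm i 1))))

-- Strips, and the bijection between words and tilings.

column : ℕ → List Cell
column i = △ (+ i) 0ℤ ∷ ▽ (+ i) 0ℤ ∷ △ (+ i) 1ℤ ∷ ▽ (+ i) 1ℤ ∷ []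

-- This is the right edge. The left edge is built into `At`, whose positions begin at 1 for `U` and
-- at 2 for `D`.
Fits : ℕ → Letter → Letter → ℕ → Set
Fits n q x i = i ≤ n × (i ≡ n → x ~ q)

-- The interface through which both families enter the bijection: finitely many columns hold all
-- cells, and the large tiles inside are those that fit.
record Strip (R : Region) (n : ℕ) (q : Letter) : Set where
  field
    _∈R?    : Decidable R
    bounded : ∀ {c} → R c → ∃[ i ] i < 2 ℕ.+ n × c ∈ column i
    fits⁺   : ∀ {x i t} → At x i t → Fits n q x i → All R (cells t)
    fits⁻   : ∀ {t} → Large t → All R (cells t) → ∃[ x ] ∃[ i ] At x i t × Fits n q x i

module _ {R : Region} {m : ℕ} {q : Letter} (S : Strip R (suc m) q) where
  open Strip S
  open Tiling

  private
    n : ℕ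
    n = suc m

  candidatesAt : ℕ → List Tile
  candidatesAt i = large△ (+ i) 0ℤ ∷ large▽ (+ i) 0ℤ ∷ map small (column i)

  candidates : List Tile
  candidates = concatMap candidatesAt (upTo (2 ℕ.+ n))

  candidate : ∀ {i t} → i < 2 ℕ.+ n → t ∈ candidatesAt i → t ∈ candidates
  candidate i< t∈ = ∈-concatMap⁺ candidatesAt (lose (∈-upTo⁺ i<) t∈)

  candidates-complete : ∀ {t} → All R (cells t) → t ∈ candidates
  candidates-complete {small c} (r ∷ _) with i , i< , c∈ ← bounded r =
    candidate i< (there (there (∈-map⁺ small c∈)))
  candidates-complete {large△ a b} inside with fits⁻ large△ inside
  ... | _ , _ , up , i<n , _ = candidate (ℕ.m≤n⇒m≤1+n (ℕ.m≤n⇒m≤1+n i<n)) (here refl)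
  candidates-complete {large▽ a b} inside with fits⁻ large▽ inside
  ... | _ , _ , down , i<n , _ =
    candidate (ℕ.m≤n⇒m≤1+n (ℕ.m≤n⇒m≤1+n (ℕ.<⇒≤ i<n))) (there (here refl))

  open module Fill (w : Word q n D) = Filling _∈R? candidates candidates-complete
    (selected? (letters w) n) (λ s → At⇒Large (proj₂ (proj₂ (selected⁻ s))))
    (selected-disjoint (letters-~ w))
    using (fill; ∈-filling⁺; large∈fill; chosen)

  selected∈fill : ∀ w {i t} → i ≤ n → At (letters w i) i t → t ∈ tiles (fill w)
  selected∈fill w {i} i≤n a =
    ∈-filling⁺ w (fits⁺ a (i≤n , λ { refl → letters-last w })) (chosen (selected⁺ i≤n a))

  -- A tile at position `n` is contained in the region, so `fits⁻` supplies the edge condition; an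
  -- `O` suits every edge.
  letterOf-last : ∀ T → letterOf T n ~ q
  letterOf-last T with letterOf-present T m
  ... | inj₁ eq = subst (_~ q) (sym eq) (O~ q)
  ... | inj₂ (t , a , t∈)
    with y , j , b , _ , edge ← fits⁻ (At⇒Large a) (All.lookup (contained T) t∈)
    with refl , refl ← At-injective b a = edge refl

  toWord : Tiling R → Word q n D
  toWord T = read n (letterOf T) (λ i _ → letterOf-compatible T i) (letterOf-last T)

  letters-toWord : ∀ T {i} → i ≤ n → letters (toWord T) i ≡ letterOf T i
  letters-toWord T =
    letters-read n (letterOf T) (λ i _ → letterOf-compatible T i) (letterOf-last T) _

  letterOf-fill : ∀ w i → i ≤ n → letterOf (fill w) i ≡ letters w i
  letterOf-fill w zero    _   = refl
  letterOf-fill w (suc i) i≤n = letterOf-unique (fill w) i (occupied i (letters-~ w i) i≤n)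
    λ a t∈ → only a (large∈fill w (At⇒Large a) t∈)
    where
    occupied : ∀ i → letters w i ~ letters w (suc i) → suc i ≤ n →
      letters w (suc i) ≡ O ⊎ ∃[ t ] At (letters w (suc i)) (suc i) t × t ∈ tiles (fill w)
    occupied i r i≤n with letters w (suc i) in eq
    ... | O = inj₁ refl
    ... | U = inj₂ (_ , up , selected∈fill w i≤n (subst (λ x → At x _ _) (sym eq) up))
    -- Position 1 follows the boundary letter `D`, so it cannot carry a `D`.
    occupied zero    () i≤n | D
    occupied (suc i) r  i≤n | D =
      inj₂ (_ , down , selected∈fill w i≤n (subst (λ x → At x _ _) (sym eq) down))

    only : ∀ {y t} → At y (suc i) t → Selected (letters w) n t → y ≡ letters w (suc i)
    only a s with j , _ , b ← selected⁻ s with refl , refl ← At-injective a b = refl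

  -- Only large tiles have to be compared. Each one in the region has a position up to `n` by
  -- `fits⁻`, and the word records its type there.
  fill-toWord : ∀ T → tiles (fill (toWord T)) ∼[ set ] tiles T
  fill-toWord T = tiling-determined (fill w) T λ l → mk⇔ (⊆ ∘ large∈fill w l) (⊇ l)
    where
    w : Word q n D
    w = toWord T

    ⊆ : ∀ {t} → Selected (letters w) n t → t ∈ tiles T
    ⊆ s with i , i≤n , a ← selected⁻ s =
      At-letterOf T (subst (λ x → At x i _) (letters-toWord T i≤n) a)

    ⊇ : ∀ {t} → Large t → t ∈ tiles T → t ∈ tiles (fill w)
    ⊇ l t∈ with x , i , a , i≤n , _ ← fits⁻ l (All.lookup (contained T) t∈) =
      selected∈fill w i≤n (subst (λ x → At x i _)
        (sym (trans (letters-toWord T i≤n) (letterOf-At T a t∈))) a)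

  -- The search runs through a list, but its outcome depends only on which tiles occur.
  letterOf-cong : ∀ (T T′ : Tiling R) →
    tiles T ∼[ set ] tiles T′ → ∀ i → letterOf T i ≡ letterOf T′ i
  letterOf-cong T T′ eq zero    = refl
  letterOf-cong T T′ eq (suc i) = letterOf-unique T i present
    λ a t∈ → sym (letterOf-At T′ a (Equivalence.to eq t∈))
    where
    present : letterOf T′ (suc i) ≡ O ⊎ ∃[ t ] At (letterOf T′ (suc i)) (suc i) t × t ∈ tiles T
    present with letterOf-present T′ i
    ... | inj₁ p = inj₁ p
    ... | inj₂ (t , a , t∈) = inj₂ (t , a , Equivalence.from eq t∈)

  toWord-unique : ∀ T w → (∀ i → i ≤ n → letterOf T i ≡ letters w i) → toWord T ≡ w
  toWord-unique T w eq = letters-injective (toWord T) w λ i i≤n →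
    trans (letters-toWord T i≤n) (eq i i≤n)

  toWord-cong : ∀ (T T′ : Tiling R) → tiles T ∼[ set ] tiles T′ → toWord T ≡ toWord T′
  toWord-cong T T′ eq = toWord-unique T (toWord T′)
    λ i i≤n → trans (letterOf-cong T T′ eq i) (sym (letters-toWord T′ i≤n))

  words↔tilings : Inverse (setoid (Word q n D)) (tilings R)
  words↔tilings = record
    { to        = fill
    ; from      = toWord
    ; to-cong   = λ { refl → mk⇔ (λ t∈ → t∈) (λ t∈ → t∈) }
    ; from-cong = λ {T} {T′} → toWord-cong T T′
    ; inverse   = (λ { {T} refl → fill-toWord T })
                , (λ {w} {T} eq → trans (toWord-cong T (fill w) eq)
                    (toWord-unique (fill w) w (letterOf-fill w)))
    }

  strip-tilings : NumberOfTilings R (count q n D)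
  strip-tilings = Composition.inverse (count-words q n D) words↔tilings

-- Parallelograms and trapezoids as strips.

b+2≤2 : ∀ {j} → + j ℤ.+ 1ℤ ℤ.+ 1ℤ ℤ.≤ + 2 → j ≡ 0
b+2≤2 {zero}  _ = refl
b+2≤2 {suc j} (ℤ.+≤+ (s≤s j+2≤1)) rewrite ℕ.+-comm j 1 | ℕ.+-comm j 1 with s≤s () ← j+2≤1

b+1≤2 : ∀ {j} → + j ℤ.+ 1ℤ ℤ.≤ + 2 → j ≡ 0 ⊎ j ≡ 1
b+1≤2 {zero}        _ = inj₁ refl
b+1≤2 {suc zero}    _ = inj₂ refl
b+1≤2 {suc (suc j)} (ℤ.+≤+ (s≤s (s≤s j+1≤0))) rewrite ℕ.+-comm j 1 with () ← j+1≤0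

module _ (Right : ℤ → ℤ → Set) where

  -- Both families share the left, bottom and top edges; `Right` is the inequality in which they
  -- differ.
  frame : Pred Point 0ℓ
  frame (a , b) = 0ℤ ℤ.≤ a × Right a b × 0ℤ ℤ.≤ b × b ℤ.≤ + 2

  -- `up⁻` and `down⁻` test one extreme vertex: (2 + i, 0) for an up tile, (2 + i, 2) for a down
  -- tile. Conversely `up⁺` and `down⁺` give `Right` on a triangle and on a box that contain all
  -- vertices of the tile's cells.
  module _ {n q}
    (right? : ∀ a b → Dec (Right a b))
    (bound : ∀ {k j} → Right (+ k) (+ j) → k < 2 ℕ.+ n)
    (up⁺ : ∀ {i} → Fits n q U (suc i) → ∀ {x y} → x ℕ.+ y ≤ 2 ℕ.+ i → Right (+ x) (+ y))
    (up⁻ : ∀ {i} → Right (+ (2 ℕ.+ i)) 0ℤ → Fits n q U (suc i))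
    (down⁺ : ∀ {i} → Fits n q D (2 ℕ.+ i) → ∀ {x y} → x ≤ 2 ℕ.+ i → y ≤ 2 → Right (+ x) (+ y))
    (down⁻ : ∀ {i} → Right (+ (2 ℕ.+ i)) (+ 2) → Fits n q D (2 ℕ.+ i))
    where

    frame? : Decidable frame
    frame? (a , b) = (0ℤ ℤ.≤? a) ×-dec (right? a b ×-dec ((0ℤ ℤ.≤? b) ×-dec (b ℤ.≤? + 2)))

    frame-bounded : ∀ {c} → cellsInside frame c → ∃[ i ] i < 2 ℕ.+ n × c ∈ column i
    frame-bounded {△ (+ k) (+ j)} ((_ , r , _ , _) ∷ _ ∷ (_ , _ , _ , top) ∷ []) with b+1≤2 {j} top
    ... | inj₁ refl = k , bound r , here refl
    ... | inj₂ refl = k , bound r , there (there (here refl))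
    frame-bounded {▽ (+ k) (+ j)} (_ ∷ (_ , r , _ , top) ∷ _ ∷ []) with b+1≤2 {j} top
    ... | inj₁ refl = k , bound r , there (here refl)
    ... | inj₂ refl = k , bound r , there (there (there (here refl)))
    frame-bounded {△ (+ k) ℤ.-[1+ j ]} ((_ , _ , () , _) ∷ _)
    frame-bounded {△ ℤ.-[1+ k ] j} ((() , _) ∷ _)
    frame-bounded {▽ (+ k) ℤ.-[1+ j ]} ((_ , _ , () , _) ∷ _)
    frame-bounded {▽ ℤ.-[1+ k ] j} (_ ∷ (() , _) ∷ _)

    point : ∀ {x y} → Right (+ x) (+ y) → y ≤ 2 → frame (+ x , + y)
    point r y≤2 = ℤ.+≤+ z≤n , r , ℤ.+≤+ z≤n , ℤ.+≤+ y≤2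

    i+1 : ∀ i → i ℕ.+ 1 ≡ 1 ℕ.+ i
    i+1 i = ℕ.+-comm i 1

    i+1+1 : ∀ i → i ℕ.+ 1 ℕ.+ 1 ≡ 2 ℕ.+ i
    i+1+1 i = trans (ℕ.+-assoc i 1 1) (ℕ.+-comm i 2)

    frame-fits⁺ : ∀ {x i t} → At x i t → Fits n q x i → All (cellsInside frame) (cells t)
    frame-fits⁺ (up {i}) f =
      (p00 ∷ p10 ∷ p01 ∷ []) ∷ (p10 ∷ p20 ∷ p11 ∷ []) ∷ (p01 ∷ p11 ∷ p02 ∷ []) ∷
      (p10 ∷ p01 ∷ p11 ∷ []) ∷ []
      where
      -- The digits in `p00`, `p10`, ... are the offsets `x` and `y` from (i , 0). The variable `k`
      -- admits the form `i + 1 + 1` in which the coordinate arises.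
      vertex : ∀ {k} x y → k ≡ x ℕ.+ i → x ℕ.+ y ≤ 2 → frame (+ k , + y)
      vertex x y refl x+y≤2 = point (up⁺ f (begin
        x ℕ.+ i ℕ.+ y    ≡⟨ ℕ.+-assoc x i y ⟩
        x ℕ.+ (i ℕ.+ y)  ≡⟨ cong (x ℕ.+_) (ℕ.+-comm i y) ⟩
        x ℕ.+ (y ℕ.+ i)  ≡⟨ ℕ.+-assoc x y i ⟨
        x ℕ.+ y ℕ.+ i    ≤⟨ ℕ.+-monoˡ-≤ i x+y≤2 ⟩
        2 ℕ.+ i          ∎)) (ℕ.m+n≤o⇒n≤o x x+y≤2)
        where open ℕ.≤-Reasoning
      p00 = vertex 0 0 refl z≤n
      p10 = vertex 1 0 (i+1 i) (s≤s z≤n)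
      p20 = vertex 2 0 (i+1+1 i) ℕ.≤-refl
      p01 = vertex 0 1 refl (s≤s z≤n)
      p11 = vertex 1 1 (i+1 i) ℕ.≤-refl
      p02 = vertex 0 2 refl ℕ.≤-refl
    frame-fits⁺ (down {i}) f =
      (p20 ∷ p11 ∷ p21 ∷ []) ∷ (p11 ∷ p02 ∷ p12 ∷ []) ∷ (p21 ∷ p12 ∷ p22 ∷ []) ∷
      (p11 ∷ p21 ∷ p12 ∷ []) ∷ []
      where
      vertex : ∀ {k} x y → k ≡ x ℕ.+ i → x ≤ 2 → y ≤ 2 → frame (+ k , + y)
      vertex x y refl x≤2 y≤2 = point (down⁺ f (ℕ.+-monoˡ-≤ i x≤2) y≤2) y≤2
      p20 = vertex 2 0 (i+1+1 i) ℕ.≤-refl z≤n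
      p21 = vertex 2 1 (i+1+1 i) ℕ.≤-refl (s≤s z≤n)
      p22 = vertex 2 2 (i+1+1 i) ℕ.≤-refl ℕ.≤-refl
      p11 = vertex 1 1 (i+1 i) (s≤s z≤n) (s≤s z≤n)
      p12 = vertex 1 2 (i+1 i) (s≤s z≤n) ℕ.≤-refl
      p02 = vertex 0 2 refl z≤n ℕ.≤-refl

    frame-fits⁻ : ∀ {t} → Large t → All (cellsInside frame) (cells t) →
      ∃[ x ] ∃[ i ] At x i t × Fits n q x i
    frame-fits⁻ (large△ {+ i} {+ j})
      ((_ ∷ (_ , _ , _ , _) ∷ _) ∷ (_ ∷ (_ , r , _) ∷ _) ∷ (_ ∷ _ ∷ (_ , _ , _ , top) ∷ []) ∷ _)
      -- The top vertex at height `j + 2` forces `j = 0`, and the right corner decides whether the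
      -- tile fits.
      with refl ← b+2≤2 {j} top = U , suc i , up ,
        up⁻ (subst (λ k → Right (+ k) 0ℤ) (i+1+1 i) r)
    frame-fits⁻ (large△ { ℤ.-[1+ _ ]} {_}) (((() , _) ∷ _) ∷ _)
    frame-fits⁻ (large△ {+ _} { ℤ.-[1+ _ ]}) (((_ , _ , () , _) ∷ _) ∷ _)
    frame-fits⁻ (large▽ {+ i} {+ j})
      (_ ∷ (_ ∷ (_ , _ , _ , top) ∷ _) ∷ (_ ∷ _ ∷ (_ , r , _) ∷ []) ∷ _)
      with refl ← b+2≤2 {j} top = D , 2 ℕ.+ i , down ,
        down⁻ (subst (λ k → Right (+ k) (+ 2)) (i+1+1 i) r)
    frame-fits⁻ (large▽ { ℤ.-[1+ _ ]} {_}) (_ ∷ (_ ∷ (() , _) ∷ _) ∷ _)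
    frame-fits⁻ (large▽ {+ _} { ℤ.-[1+ _ ]}) (((_ , _ , () , _) ∷ _) ∷ _)

    frame-strip : Strip (cellsInside frame) n q
    frame-strip = record
      { _∈R?    = λ c → All.all? frame? (vertices c)
      ; bounded = frame-bounded
      ; fits⁺   = frame-fits⁺
      ; fits⁻   = frame-fits⁻
      }

parallelogram-strip : ∀ n → Strip (parallelogram n) n U
parallelogram-strip n = frame-strip (λ a _ → a ℤ.≤ + n)
  (λ a _ → a ℤ.≤? + n)
  (λ { (ℤ.+≤+ k≤n) → s≤s (ℕ.m≤n⇒m≤1+n k≤n) })
  -- `U ~ U` is empty, so `edge` says `suc i ≢ n` and improves `suc i ≤ n` to `2 + i ≤ n`.
  (λ { {i} (i<n , edge) {x} {y} x+y≤2+i →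
         ℤ.+≤+ (ℕ.≤-trans (ℕ.m≤m+n x y) (ℕ.≤-trans x+y≤2+i (ℕ.≤∧≢⇒< i<n edge))) })
  (λ { (ℤ.+≤+ 2+i≤n) → ℕ.<⇒≤ 2+i≤n , ℕ.<⇒≢ 2+i≤n })
  (λ { (2+i≤n , _) x≤2+i _ → ℤ.+≤+ (ℕ.≤-trans x≤2+i 2+i≤n) })
  (λ { (ℤ.+≤+ 2+i≤n) → 2+i≤n , λ _ → tt })

trapezoid-strip : ∀ n → Strip (trapezoid n) n D
trapezoid-strip n = frame-strip (λ a b → a ℤ.+ b ℤ.≤ + suc n)
  (λ a b → a ℤ.+ b ℤ.≤? + suc n)
  (λ { {k} {j} (ℤ.+≤+ k+j≤1+n) → s≤s (ℕ.≤-trans (ℕ.m≤m+n k j) k+j≤1+n) })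
  (λ { (i<n , _) x+y≤2+i → ℤ.+≤+ (ℕ.≤-trans x+y≤2+i (s≤s i<n)) })
  (λ { {i} (ℤ.+≤+ 2+i+0≤1+n) →
         ℕ.s≤s⁻¹ (subst (_≤ suc n) (ℕ.+-identityʳ (2 ℕ.+ i)) 2+i+0≤1+n) , λ _ → tt })
  -- Here `D` meets `D`: the vertex (2 + i, 2) needs `4 + i ≤ n + 1`, which is `2 + i ≤ n` with
  -- equality excluded by `edge`.
  (λ { {i} (2+i≤n , edge) x≤2+i y≤2 → ℤ.+≤+ (ℕ.≤-trans (ℕ.+-mono-≤ x≤2+i y≤2)
         (subst (_≤ suc n) (ℕ.+-comm 2 (2 ℕ.+ i)) (s≤s (ℕ.≤∧≢⇒< 2+i≤n edge)))) })
  (λ { {i} (ℤ.+≤+ 2+i+2≤1+n) →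
         let 3+i≤n = ℕ.s≤s⁻¹ (subst (_≤ suc n) (ℕ.+-comm (2 ℕ.+ i) 2) 2+i+2≤1+n)
         in ℕ.<⇒≤ 3+i≤n , ℕ.<⇒≢ 3+i≤n })

-- The two counts and their formulas.

theorem3 : Σ[ A ∈ (ℕ → ℕ) ] Σ[ B ∈ (ℕ → ℕ) ]
    (∀ (n : ℕ) → 1 ≤ n → NumberOfTilings (parallelogram n) (A n))
    × (∀ (n : ℕ) → 1 ≤ n → NumberOfTilings (trapezoid n) (B n))
    × A 1 ≡ 1 × A 2 ≡ 4 × B 1 ≡ 2 × B 2 ≡ 3
    × (∀ (n : ℕ) → 1 ≤ n →
    fromℕ (A n) ≡ ¼ * ((1# + √2) ^ suc n + (1# - √2) ^ suc n) + ½ * -1# ^ n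
    × fromℕ (A n) ≡ ½ * H (suc n) + ½ * -1# ^ n
    × fromℕ (B n) ≡ ¼ * ((1# + √2) ^ suc n + (1# - √2) ^ suc n) - ½ * -1# ^ n
    × fromℕ (B n) ≡ ½ * H (suc n) - ½ * -1# ^ n)
    × map A (1 ∷ 2 ∷ 3 ∷ 4 ∷ 5 ∷ 6 ∷ 7 ∷ []) ≡ 1 ∷ 4 ∷ 8 ∷ 21 ∷ 49 ∷ 120 ∷ 288 ∷ []
    × map B (1 ∷ 2 ∷ 3 ∷ 4 ∷ 5 ∷ 6 ∷ 7 ∷ []) ≡ 2 ∷ 3 ∷ 9 ∷ 20 ∷ 50 ∷ 119 ∷ 289 ∷ []
theorem3 = A , B
  , (λ { (suc m) _ → strip-tilings (parallelogram-strip (suc m)) })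
  , (λ { (suc m) _ → strip-tilings (trapezoid-strip (suc m)) })
  , refl , refl , refl , refl
  , (λ n _ → formula⁺ n , trans (formula⁺ n) (cong (_+ ½ * -1# ^ n) (quarter-sum n))
           , B-formula n , trans (B-formula n) (cong (_- ½ * -1# ^ n) (quarter-sum n)))
  , refl , refl
  where
  A B : ℕ → ℕ
  A n = count U n D
  B n = count D n D

  B-formula : ∀ n → fromℕ (B n) ≡ ¼ * ((1# + √2) ^ suc n + (1# - √2) ^ suc n) - ½ * -1# ^ n
  B-formula n = trans (cong fromℕ (count-swap U n U)) (formula⁻ n)

  quarter-sum : ∀ n → ¼ * ((1# + √2) ^ suc n + (1# - √2) ^ suc n) ≡ ½ * H (suc n)
  quarter-sum n = sym (½*½ ((1# + √2) ^ suc n + (1# - √2) ^ suc n))
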